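{- Let $k\geq 4$ and let $G$ be a graph with maximum degree $\Delta(G)\le k$ that is $(k-1)$-saturated. Then $G$ is $(1^{k-1},2^{k-1})$-packing colorable.
   Context: Graphs are finite and simple; $\mathrm{dist}(x,y)$ is the usual shortest-path distance. For a non-decreasing sequence of positive integers $S=(s_1,\dots,s_p)$, an $S$-packing coloring of $G$ is a partition of $V(G)$ into sets $V_1,\dots,V_p$ such that any two distinct vertices of $V_i$ are at distance greater than $s_i$, for each $1\le i\le p$; $G$ is $S$-packing colorable if such a partition exists. The notation $i^r$ in a sequence means that $i$ is repeated $r$ times, so $(1^{k-1},2^{k-1})$ is the sequence of $k-1$ ones followed by $k-1$ twos. A vertex of degree $k$ is called a $k$-vertex. A graph $G$ with $\Delta(G)\le k$ is called $t$-saturated ($0\le t\le k$) if every $k$-vertex of $G$ is adjacent to at most $t$ vertices of degree $k$. -}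

module Defs where

open import Data.Nat using (ℕ; zero; suc; _≤_; _>_; _∸_; _≡ᵇ_)
open import Data.Fin using (Fin)
open import Data.Bool using (Bool; true; false; _∧_)
open import Data.List using (List; length; filterᵇ; allFin; replicate; _++_; lookup)
open import Data.Product using (∃; _×_)
open import Relation.Binary.PropositionalEquality using (_≡_)
open import Relation.Nullary using (¬_)

record Graph : Set where
  field
    n      : ℕ
    adj    : Fin n → Fin n → Bool
    sym    : ∀ x y → adj x y ≡ adj y x
    irrefl : ∀ x → adj x x ≡ false

module _ (G : Graph) where
  open Graph G

  degree : Fin n → ℕ
  degree x = length (filterᵇ (adj x) (allFin n))

  MaxDegreeLe : ℕ → Set
  MaxDegreeLe k = ∀ x → degree x ≤ k

  degNeighbours : ℕ → Fin n → ℕ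
  degNeighbours k x = length (filterᵇ (λ y → adj x y ∧ (degree y ≡ᵇ k)) (allFin n))

  Saturated : ℕ → ℕ → Set
  Saturated k t = MaxDegreeLe k × (∀ x → degree x ≡ k → degNeighbours k x ≤ t)

  data Walk : Fin n → Fin n → ℕ → Set where
    here : ∀ {x} → Walk x x zero
    step : ∀ {x y z m} → adj x y ≡ true → Walk y z m → Walk x z (suc m)

  DistLe : Fin n → Fin n → ℕ → Set
  DistLe x y d = ∃ λ m → m ≤ d × Walk x y m

  PackingColoring : (S : List ℕ) → (Fin n → Fin (length S)) → Set
  PackingColoring S c = ∀ x y → ¬ (x ≡ y) → c x ≡ c y → ¬ DistLe x y (lookup S (c x))

  PackingColorable : List ℕ → Set
  PackingColorable S = ∃ λ (c : Fin n → Fin (length S)) → PackingColoring S c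

seq1-2 : ℕ → List ℕ
seq1-2 k = replicate (k ∸ 1) 1 ++ replicate (k ∸ 1) 2

module Submission where

-- Write k = q + 1.  Take q disjoint independent sets such that, for the set R of uncovered
-- vertices, (k + 1)|R| plus the number of edges leaving R is minimal.
-- Every vertex of R sees each of the q classes, so it has at most one neighbour in R.  Swapping
-- a vertex of R with a neighbour that is alone in its class shows: two vertices of R having
-- neighbours in R are at distance at most 2 only if they are adjacent, and a vertex r of R
-- without neighbours in R shares such a lone neighbour with no other vertex of R.  So r is close
-- to others only through the at most two neighbours u, w that lie in a common class.  If u has
-- three neighbours in R, it can be moved to another class, whereupon w becomes lone; saturation
-- then prevents all neighbours of u from lying in R.  Hence r has at most q - 1 vertices of R
-- within distance 2 (here k ≥ 4 is used), and R is coloured greedily with q colours,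
-- starting with the vertices that have a neighbour in R.

open import Defs
import Algebra.Properties.CommutativeMonoid.Sum
open import Data.Bool using (Bool; true; false; _∧_; not; if_then_else_)
open import Data.Bool.Properties using (T?; T-≡; ∧-conicalˡ; ∧-conicalʳ; ∧-identityʳ; ∧-zeroʳ)
  renaming (_≟_ to _≟ᵇ_)
open import Data.Fin using (Fin; zero; suc; fromℕ<; punchIn; _≟_)
open import Data.Fin.Properties using (any?; all?; pigeonhole; punchInᵢ≢i; <⇒≢; suc-injective)
open import Data.List using (List; []; _∷_; _++_; length; map; filterᵇ; tabulate; allFin; replicate)
import Data.List as List
open import Data.List.Properties using (length-map; length-++; ++-identityʳ)
open import Data.List.Membership.Propositional using (_∈_; _∉_)
open import Data.List.Membership.Propositional.Properties
  using (∈-filter⁺; ∈-filter⁻; ∈-allFin; ∈-map⁺; ∈-++⁺ˡ; ∈-++⁺ʳ; ∈-++⁻; ∈-length)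
open import Data.List.Relation.Unary.Any using (here; there; index)
open import Data.List.Relation.Unary.Any.Properties using (lookup-index)
open import Data.Nat using (ℕ; zero; suc; _+_; _∸_; _≤_; _<_; z≤n; s≤s; _≤?_; _<?_; _≡ᵇ_)
open import Data.Nat.Induction using (<-wellFounded)
open import Data.Nat.Properties hiding (_≟_; 0≢1+n; suc-injective; <⇒≢)
open import Data.Nat.Solver using (module +-*-Solver)
open import Data.Product using (∃; _×_; _,_; proj₁; proj₂)
open import Data.Sum using (_⊎_; inj₁; inj₂)
open import Data.Sum.Properties using (inj₂-injective)
open import Data.Vec using (Vec; lookup; _[_]≔_) renaming ([] to []ᵛ; _∷_ to _∷ᵛ_; replicate to replicateᵛ)
open import Data.Vec.Properties using (lookup∘update; lookup∘update′; []≔-idempotent; []≔-lookup; lookup-replicate)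
open import Function using (_∘_; Equivalence)
open import Induction.WellFounded using (Acc; acc)
open import Relation.Binary.Definitions using (Symmetric)
open import Relation.Binary.PropositionalEquality
open import Relation.Nullary using (¬_; Dec; yes; no; contradiction)
open import Relation.Nullary.Decidable using (¬?; _×-dec_; _→-dec_; decidable-stable; map′; does; dec-true; dec-false)
open Algebra.Properties.CommutativeMonoid.Sum +-0-commutativeMonoid
  using (sum; sum-remove; sum-cong-≗; ∑-distrib-+)
open +-*-Solver using (solve; _:+_; _:=_; con)

private variable
  m n : ℕ

-- Counting

boolToℕ : Bool → ℕ
boolToℕ b = if b then 1 else 0

select : (Fin n → Bool) → List (Fin n)
select P = filterᵇ P (allFin _)

count : (Fin n → Bool) → ℕ
count P = length (select P)

without : (Fin n → Bool) → Fin n → Fin n → Bool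
without P x y = P y ∧ not (does (y ≟ x))

∈-select⁺ : {P : Fin n → Bool} {x : Fin n} → P x ≡ true → x ∈ select P
∈-select⁺ {P = P} {x} Px = ∈-filter⁺ (T? ∘ P) (∈-allFin x) (Equivalence.from T-≡ Px)

∈-select⁻ : {P : Fin n → Bool} {x : Fin n} → x ∈ select P → P x ≡ true
∈-select⁻ {P = P} x∈ = Equivalence.to T-≡ (proj₂ (∈-filter⁻ (T? ∘ P) {xs = allFin _} x∈))

without⁺ : (P : Fin n → Bool) {x y : Fin n} → P y ≡ true → y ≢ x → without P x y ≡ true
without⁺ P {x} {y} Py y≢x rewrite dec-false (y ≟ x) y≢x = trans (∧-identityʳ (P y)) Py

without-self : (P : Fin n → Bool) (x : Fin n) → without P x x ≡ false
without-self P x rewrite dec-true (x ≟ x) refl = ∧-zeroʳ (P x)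

count≡sum : (P : Fin n → Bool) → count P ≡ sum (boolToℕ ∘ P)
count≡sum P = go P (λ i → i)
  where
  go : {A : Set} (P : A → Bool) (g : Fin m → A) →
       length (filterᵇ P (tabulate g)) ≡ sum (boolToℕ ∘ P ∘ g)
  go {zero}  P g = refl
  go {suc m} P g with P (g zero)
  ... | true  = cong suc (go P (g ∘ suc))
  ... | false = go P (g ∘ suc)

-- The values at `i` stand crosswise on the two sides, so that the difference of the sums is
-- expressed without subtraction.
sum-agree-off : (F F′ : Fin n → ℕ) (i : Fin n) → (∀ j → j ≢ i → F j ≡ F′ j) →
                sum F + F′ i ≡ sum F′ + F i
sum-agree-off {suc n} F F′ i eq = begin
  sum F + F′ i                            ≡⟨ cong (_+ F′ i) (sum-remove {i = i} F) ⟩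
  F i + sum (F ∘ punchIn i) + F′ i        ≡⟨ cong (λ s → F i + s + F′ i)
                                               (sum-cong-≗ λ j → eq (punchIn i j) (punchInᵢ≢i i j)) ⟩
  F i + sum (F′ ∘ punchIn i) + F′ i       ≡⟨ solve 3 (λ a b c → a :+ b :+ c := c :+ b :+ a) refl
                                               (F i) (sum (F′ ∘ punchIn i)) (F′ i) ⟩
  F′ i + sum (F′ ∘ punchIn i) + F i       ≡⟨ cong (_+ F i) (sum-remove {i = i} F′) ⟨
  sum F′ + F i                            ∎
  where open ≡-Reasoning

count-cong : {P P′ : Fin n → Bool} → P ≗ P′ → count P ≡ count P′
count-cong {P = P} {P′} eq =
  trans (count≡sum P) (trans (sum-cong-≗ (cong boolToℕ ∘ eq)) (sym (count≡sum P′)))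

count-agree-off : (P P′ : Fin n → Bool) (i : Fin n) → (∀ j → j ≢ i → P j ≡ P′ j) →
                  count P + boolToℕ (P′ i) ≡ count P′ + boolToℕ (P i)
count-agree-off P P′ i eq rewrite count≡sum P | count≡sum P′ =
  sum-agree-off (boolToℕ ∘ P) (boolToℕ ∘ P′) i (λ j j≢i → cong boolToℕ (eq j j≢i))

count-without : (P : Fin n → Bool) {x : Fin n} → P x ≡ true → count P ≡ suc (count (without P x))
count-without P {x} Px = begin
  count P                                    ≡⟨ +-identityʳ _ ⟨
  count P + 0                                ≡⟨ cong (λ b → count P + boolToℕ b) (without-self P x) ⟨
  count P + boolToℕ (without P x x)          ≡⟨ count-agree-off P (without P x) x agree ⟩
  count (without P x) + boolToℕ (P x)        ≡⟨ cong (λ b → count (without P x) + boolToℕ b) Px ⟩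
  count (without P x) + 1                    ≡⟨ +-comm _ 1 ⟩
  suc (count (without P x))                  ∎
  where
  open ≡-Reasoning
  agree : ∀ j → j ≢ x → P j ≡ without P x j
  agree j j≢x rewrite dec-false (j ≟ x) j≢x = sym (∧-identityʳ (P j))

count-split : (P Q : Fin n → Bool) →
              count P ≡ count (λ x → P x ∧ Q x) + count (λ x → P x ∧ not (Q x))
count-split P Q
  rewrite count≡sum P | count≡sum (λ x → P x ∧ Q x) | count≡sum (λ x → P x ∧ not (Q x)) =
  trans (sum-cong-≗ λ x → split (P x) (Q x)) (∑-distrib-+ (λ x → boolToℕ (P x ∧ Q x)) (λ x → boolToℕ (P x ∧ not (Q x))))
  where
  split : ∀ a b → boolToℕ a ≡ boolToℕ (a ∧ b) + boolToℕ (a ∧ not b)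
  split false _     = refl
  split true  false = refl
  split true  true  = refl

count-pos : (P : Fin n → Bool) {x : Fin n} → P x ≡ true → 1 ≤ count P
count-pos P Px = ∈-length (∈-select⁺ {P = P} Px)

two⇒2≤count : (P : Fin n → Bool) {x y : Fin n} → x ≢ y → P x ≡ true → P y ≡ true → 2 ≤ count P
two⇒2≤count P x≢y Px Py =
  ≤-trans (s≤s (count-pos (without P _) (without⁺ P Py (x≢y ∘ sym)))) (≤-reflexive (sym (count-without P Px)))

count≤1⇒unique : (P : Fin n → Bool) → count P ≤ 1 → {x y : Fin n} →
                 P x ≡ true → P y ≡ true → x ≡ y
count≤1⇒unique P c≤1 {x} {y} Px Py =
  decidable-stable (x ≟ y) λ x≢y → contradiction (≤-trans (two⇒2≤count P x≢y Px Py) c≤1) λ { (s≤s ()) }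

count≡0⇒none : (P : Fin n → Bool) → count P ≡ 0 → {x : Fin n} → P x ≢ true
count≡0⇒none P c≡0 Px = contradiction (subst (1 ≤_) c≡0 (count-pos P Px)) λ ()

none-or-some : (P : Fin n → Bool) → count P ≡ 0 ⊎ ∃ λ x → P x ≡ true
none-or-some P with select P in eq
... | []    = inj₁ refl
... | x ∷ _ = inj₂ (x , ∈-select⁻ {P = P} (subst (x ∈_) (sym eq) (here refl)))

-- Minimisation over finite function spaces and greedy colouring

-- Exhaustive search, entry by entry. Vectors instead of functions spare the assumption that `P`
-- respects pointwise equality.
anyVec? : ∀ n {P : Vec (Fin m) n → Set} → (∀ v → Dec (P v)) → Dec (∃ P)
anyVec? zero P? = map′ ([]ᵛ ,_) (λ { ([]ᵛ , p) → p }) (P? []ᵛ)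
anyVec? (suc n) P? =
  map′ (λ { (a , v , p) → a ∷ᵛ v , p }) (λ { (a ∷ᵛ v , p) → a , v , p })
       (any? λ a → anyVec? n λ v → P? (a ∷ᵛ v))

-- Descent: as long as some admissible vector has smaller `Φ`, pass to it; well-foundedness of `_<_`
-- ends the search.
minimiser : {P : Vec (Fin m) n → Set} → (∀ v → Dec (P v)) → (Φ : Vec (Fin m) n → ℕ) →
            ∃ P → ∃ λ v → P v × (∀ w → P w → Φ v ≤ Φ w)
minimiser {n = n} {P} P? Φ (v₀ , p₀) = go v₀ p₀ (<-wellFounded (Φ v₀))
  where
  go : ∀ v → P v → Acc _<_ (Φ v) → ∃ λ v → P v × (∀ w → P w → Φ v ≤ Φ w)
  go v p (acc rs) with anyVec? n (λ w → P? w ×-dec (Φ w <? Φ v))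
  ... | yes (w , q , w<v) = go w q (rs w<v)
  ... | no ¬better = v , p , λ w q → ≮⇒≥ λ w<v → ¬better (w , q , w<v)

-- If all `m` colours occurred, sending each to its position in the shorter list would identify two
-- of them.
freeColour : (cs : List (Fin m)) → length cs < m → ∃ λ c → c ∉ cs
freeColour {m} cs short = decidable-stable (any? λ c → ¬? (c ∈? cs)) λ allUsed →
  let used : ∀ c → c ∈ cs
      used c = decidable-stable (c ∈? cs) λ c∉ → allUsed (c , c∉)
      i , j , i<j , eq = pigeonhole short (index ∘ used)
  in <⇒≢ i<j (trans (lookup-index (used i))
               (trans (cong (List.lookup cs) eq) (sym (lookup-index (used j)))))
  where open import Data.List.Membership.DecPropositional (_≟_ {m}) using (_∈?_)

module _ {H : Fin n → Fin n → Set} (H-sym : Symmetric H) {p : ℕ} where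

  ProperOn : List (Fin n) → (Fin n → Fin p) → Set
  ProperOn xs g = ∀ {x y} → x ∈ xs → y ∈ xs → x ≢ y → H x y → g x ≢ g y

  FewNeighbours : List (Fin n) → Fin n → Set
  FewNeighbours zs x = ∃ λ bad → length bad < p × (∀ {y} → y ∈ zs → x ≢ y → H x y → y ∈ bad)

  -- The vertices of `xs` are added from last to first to a colouring of `ys`. Nothing is asked of
  -- the degrees in `ys`, so the order of colouring matters.
  greedy : ∀ xs ys → (∀ {x} → x ∈ xs → FewNeighbours (xs ++ ys) x) →
           ∃ (ProperOn ys) → ∃ (ProperOn (xs ++ ys))
  greedy [] ys few g = g
  greedy (x ∷ xs) ys few g₀
    with g , proper ← greedy xs ys
           (λ x∈ → let bad , short , catch = few (there x∈) in bad , short , catch ∘ there) g₀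
    with bad , short , catch ← few (here refl)
    with c , c∉ ← freeColour (map g bad) (subst (_< p) (sym (length-map g bad)) short)
    = g′ , proper′
    where
    g′ : Fin n → Fin p
    g′ y = if does (y ≟ x) then c else g y

    g′-self : g′ x ≡ c
    g′-self rewrite dec-true (x ≟ x) refl = refl

    g′-other : ∀ {y} → y ≢ x → g′ y ≡ g y
    g′-other {y} y≢x rewrite dec-false (y ≟ x) y≢x = refl

    fresh : ∀ {y} → y ∈ x ∷ xs ++ ys → x ≢ y → H x y → c ≢ g y
    fresh y∈ x≢y h refl = c∉ (∈-map⁺ g (catch y∈ x≢y h))

    tail : ∀ {y} → y ∈ x ∷ xs ++ ys → y ≢ x → y ∈ xs ++ ys
    tail (here y≡x) y≢x = contradiction y≡x y≢x
    tail (there y∈) _   = y∈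

    proper′ : ProperOn (x ∷ xs ++ ys) g′
    proper′ {y} {z} y∈ z∈ y≢z h eq with y ≟ x | z ≟ x
    ... | yes refl | yes refl = y≢z refl
    ... | yes refl | no z≢x  = fresh z∈ y≢z h eq
    ... | no y≢x | yes refl  = fresh y∈ (y≢x ∘ sym) (H-sym h) (sym eq)
    ... | no y≢x | no z≢x    = proper (tail y∈ y≢x) (tail z∈ z≢x) y≢z h eq

-- Partial colourings of least weight

isZero : Fin m → Bool
isZero zero    = true
isZero (suc _) = false

isZero⇒≡ : {l : Fin (suc m)} → isZero l ≡ true → l ≡ zero
isZero⇒≡ {l = zero} _ = refl

≢⇒¬isZero : {l : Fin (suc m)} → l ≢ zero → isZero l ≡ false
≢⇒¬isZero {l = zero}  l≢0 = contradiction refl l≢0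
≢⇒¬isZero {l = suc _} _   = refl

-- With `x` the least weight and `y` the weight of a competitor, this turns a weight balance into an
-- inequality between degrees.
+-cancel-≤-≡ : ∀ {x y s t} → x ≤ y → y + s ≡ x + t → s ≤ t
+-cancel-≤-≡ {x} {y} {s} {t} x≤y eq =
  +-cancelˡ-≤ x s t (≤-trans (+-monoˡ-≤ s x≤y) (≤-reflexive eq))

-- The class zero collects the uncoloured vertices; the other q classes are independent sets.
module PartialColourings (G : Graph) (q : ℕ) (Δ≤1+q : MaxDegreeLe G (suc q)) where

  open Graph G renaming (n to order; sym to adj-sym)

  Vertex Class Colouring : Set
  Vertex    = Fin order
  Class     = Fin (suc q)
  Colouring = Vec Class order

  Adj : Vertex → Vertex → Set
  Adj x y = adj x y ≡ true

  Adj? : ∀ x y → Dec (Adj x y)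
  Adj? x y = adj x y ≟ᵇ true

  Adj-sym : ∀ {x y} → Adj x y → Adj y x
  Adj-sym {x} {y} = trans (adj-sym y x)

  ¬Adj-refl : ∀ {x} → ¬ Adj x x
  ¬Adj-refl {x} xx with () ← trans (sym xx) (irrefl x)

  blank : Colouring → Vertex → Bool
  blank v x = isZero (lookup v x)

  -- Outer means outside the classes: `outer` selects the uncoloured neighbours and `inner` the
  -- coloured ones.
  outer inner : Colouring → Vertex → Vertex → Bool
  outer v x y = adj x y ∧ blank v y
  inner v x y = adj x y ∧ not (blank v y)

  outdeg indeg : Colouring → Vertex → ℕ
  outdeg v x = count (outer v x)
  indeg  v x = count (inner v x)

  outer⁺ : ∀ v {x y} → Adj x y → lookup v y ≡ zero → outer v x y ≡ true
  outer⁺ v xy y₀ = cong₂ _∧_ xy (cong isZero y₀)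

  inner⁺ : ∀ v {x y} → Adj x y → lookup v y ≢ zero → inner v x y ≡ true
  inner⁺ v xy y≢0 = cong₂ (λ a b → a ∧ not b) xy (≢⇒¬isZero y≢0)

  degree-split : ∀ v x → degree G x ≡ outdeg v x + indeg v x
  degree-split v x = count-split (adj x) (blank v)

  out+in≤1+q : ∀ v x → outdeg v x + indeg v x ≤ suc q
  out+in≤1+q v x = ≤-trans (≤-reflexive (sym (degree-split v x))) (Δ≤1+q x)

  record Proper (v : Colouring) : Set where
    constructor proper
    field monochromatic⇒blank : ∀ x y → Adj x y → lookup v x ≡ lookup v y → lookup v x ≡ zero

  open Proper

  proper? : ∀ v → Dec (Proper v)
  proper? v = map′ proper monochromatic⇒blank (all? λ x → all? λ y →
    Adj? x y →-dec ((lookup v x ≟ lookup v y) →-dec (lookup v x ≟ zero)))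

  erase : Colouring → Vertex → Colouring
  erase v x = v [ x ]≔ zero

  -- Allowing a conflict when `l ≡ zero` lets the same lemma cover erasing a vertex.
  recolour-proper : ∀ {v} → Proper v → ∀ x l → (∀ y → Adj x y → lookup v y ≡ l → l ≡ zero) →
                    Proper (v [ x ]≔ l)
  recolour-proper {v} pr x l ok = proper go
    where
    go : ∀ y z → Adj y z → lookup (v [ x ]≔ l) y ≡ lookup (v [ x ]≔ l) z → lookup (v [ x ]≔ l) y ≡ zero
    go y z yz eq with y ≟ x | z ≟ x
    ... | yes refl | yes refl = contradiction yz ¬Adj-refl
    ... | yes refl | no z≢x
      rewrite lookup∘update x v l | lookup∘update′ z≢x v l = ok z yz (sym eq)
    ... | no y≢x | yes refl
      rewrite lookup∘update x v l | lookup∘update′ y≢x v l = trans eq (ok y (Adj-sym yz) eq)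
    ... | no y≢x | no z≢x
      rewrite lookup∘update′ y≢x v l | lookup∘update′ z≢x v l = monochromatic⇒blank pr y z yz eq

  erase-proper : ∀ {v} → Proper v → ∀ x → Proper (erase v x)
  erase-proper pr x = recolour-proper pr x zero λ _ _ _ → refl

  erase-restore : ∀ v x → (erase v x) [ x ]≔ lookup v x ≡ v
  erase-restore v x = trans ([]≔-idempotent v x) ([]≔-lookup v x)

  erase-blank : ∀ v x {y} → lookup v y ≡ zero → lookup (erase v x) y ≡ zero
  erase-blank v x {y} y₀ with y ≟ x
  ... | yes refl = lookup∘update x v zero
  ... | no y≢x   = trans (lookup∘update′ y≢x v zero) y₀

  -- The summand 2 + q exceeds all degrees, so that colouring one more vertex always decreases the weight.
  weightAt : Colouring → Vertex → ℕ
  weightAt v x = if blank v x then suc (suc q) + indeg v x else 0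

  weight : Colouring → ℕ
  weight v = sum (weightAt v)

  module _ (v : Colouring) {x : Vertex} {l : Class} (x₀ : lookup v x ≡ zero) (l≢0 : l ≢ zero) where

    private
      v′ = v [ x ]≔ l

      blank-x : blank v x ≡ true
      blank-x = cong isZero x₀

      blank′-x : blank v′ x ≡ false
      blank′-x = trans (cong isZero (lookup∘update x v l)) (≢⇒¬isZero l≢0)

      blank′-other : ∀ {y} → y ≢ x → blank v′ y ≡ blank v y
      blank′-other y≢x = cong isZero (lookup∘update′ y≢x v l)

    indeg-colour : ∀ y → indeg v′ y ≡ indeg v y + boolToℕ (adj y x)
    indeg-colour y
      with eq ← count-agree-off (inner v′ y) (inner v y) x
                  (λ z z≢x → cong (λ b → adj y z ∧ not b) (blank′-other z≢x))
      rewrite blank-x | blank′-x | ∧-identityʳ (adj y x) | ∧-zeroʳ (adj y x)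
      = trans (sym (+-identityʳ _)) eq

    outdeg-colour : ∀ y → outdeg v y ≡ outdeg v′ y + boolToℕ (adj y x)
    outdeg-colour y
      with eq ← count-agree-off (outer v y) (outer v′ y) x
                  (λ z z≢x → cong (adj y z ∧_) (sym (blank′-other z≢x)))
      rewrite blank-x | blank′-x | ∧-identityʳ (adj y x) | ∧-zeroʳ (adj y x)
      = trans (sym (+-identityʳ _)) eq

    -- Colouring `x` removes the summand of `x`, while each uncoloured neighbour of `x` gains one
    -- edge into the classes.
    weight-colour : weight v + outdeg v x ≡ weight v′ + (suc (suc q) + indeg v x)
    weight-colour = begin
      weight v + outdeg v x                        ≡⟨ cong (weight v +_) (count≡sum (outer v x)) ⟩
      weight v + sum gain                          ≡⟨ ∑-distrib-+ (weightAt v) gain ⟨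
      sum before                                   ≡⟨ +-identityʳ _ ⟨
      sum before + 0                               ≡⟨ cong (sum before +_) weightAt′-x ⟨
      sum before + weightAt v′ x                   ≡⟨ sum-agree-off before (weightAt v′) x elsewhere ⟩
      weight v′ + before x                         ≡⟨ cong (weight v′ +_) before-x ⟩
      weight v′ + (suc (suc q) + indeg v x)        ∎
      where
      open ≡-Reasoning
      gain before : Vertex → ℕ
      gain y   = boolToℕ (outer v x y)
      -- The old summands, raised by one at each uncoloured neighbour of `x`, agree with the new
      -- ones everywhere except at `x`.
      before y = weightAt v y + gain y

      weightAt′-x : weightAt v′ x ≡ 0
      weightAt′-x rewrite blank′-x = refl

      before-x : before x ≡ suc (suc q) + indeg v x
      before-x rewrite blank-x | irrefl x = +-identityʳ _

      elsewhere : ∀ y → y ≢ x → before y ≡ weightAt v′ y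
      elsewhere y y≢x rewrite blank′-other y≢x with blank v y
      ... | false rewrite ∧-zeroʳ (adj x y) = refl
      ... | true rewrite ∧-identityʳ (adj x y) | adj-sym x y | indeg-colour y =
        +-assoc (suc (suc q)) (indeg v y) _

  module _ (v : Colouring) (x : Vertex) (x≢0 : lookup v x ≢ zero) where

    private
      v₁ = erase v x

    -- Erasing is colouring read backwards: giving `x` its old class in `v₁` restores `v`, so the
    -- formulas for colouring apply to `v₁`.
    indeg-erase : ∀ y → indeg v y ≡ indeg v₁ y + boolToℕ (adj y x)
    indeg-erase y = trans (cong (λ u → indeg u y) (sym (erase-restore v x)))
                          (indeg-colour v₁ (lookup∘update x v zero) x≢0 y)

    outdeg-erase : ∀ y → outdeg v₁ y ≡ outdeg v y + boolToℕ (adj y x)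
    outdeg-erase y = trans (outdeg-colour v₁ (lookup∘update x v zero) x≢0 y)
                           (cong (λ u → outdeg u y + boolToℕ (adj y x)) (erase-restore v x))

    weight-erase : weight v₁ + outdeg v x ≡ weight v + (suc (suc q) + indeg v x)
    weight-erase = begin
      weight v₁ + outdeg v x                      ≡⟨ cong (weight v₁ +_) out-x ⟨
      weight v₁ + outdeg v₁ x                     ≡⟨ weight-colour v₁ (lookup∘update x v zero) x≢0 ⟩
      weight (v₁ [ x ]≔ lookup v x) + (suc (suc q) + indeg v₁ x)
        ≡⟨ cong₂ (λ u d → weight u + (suc (suc q) + d)) (erase-restore v x) (sym in-x) ⟩
      weight v + (suc (suc q) + indeg v x)        ∎
      where
      open ≡-Reasoning
      out-x : outdeg v₁ x ≡ outdeg v x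
      out-x with eq ← outdeg-erase x rewrite irrefl x = trans eq (+-identityʳ _)
      in-x : indeg v x ≡ indeg v₁ x
      in-x with eq ← indeg-erase x rewrite irrefl x = trans eq (+-identityʳ _)

  -- Swapping an uncoloured vertex with a coloured neighbour

  -- This is what allows `r` to enter the class of `x` once `x` has left it.
  Sole : Colouring → Vertex → Vertex → Set
  Sole v r x = ∀ y → Adj r y → lookup v y ≡ lookup v x → y ≡ x

  swap : Colouring → Vertex → Vertex → Colouring
  swap v r x = (erase v x) [ r ]≔ lookup v x

  module _ (v : Colouring) {r x : Vertex} (r₀ : lookup v r ≡ zero) (x≢0 : lookup v x ≢ zero) where

    private
      v₁ = erase v x

    swap-proper : Proper v → Sole v r x → Proper (swap v r x)
    swap-proper pr sole = recolour-proper (erase-proper pr x) r (lookup v x) ok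
      where
      ok : ∀ y → Adj r y → lookup v₁ y ≡ lookup v x → lookup v x ≡ zero
      ok y ry eq with y ≟ x
      ... | yes refl = trans (sym eq) (lookup∘update x v zero)
      ... | no y≢x   = contradiction (sole y ry (trans (sym (lookup∘update′ y≢x v zero)) eq)) y≢x

    -- The balances of erasing `x` and of colouring `r`, added. The `2` comes from the edge between
    -- them: erasing `x` raises the outer degree of `r` by one and lowers its inner degree by one.
    swap-weight : Adj r x → weight (swap v r x) + (outdeg v x + indeg v r)
                          ≡ weight v + (indeg v x + outdeg v r + 2)
    swap-weight rx = +-cancelˡ-≡ K _ _ (begin
      K + (W₂ + (outdeg v x + indeg v r))     ≡⟨ cong (λ d → K + (W₂ + (outdeg v x + d))) in-r ⟩
      K + (W₂ + (outdeg v x + (I + 1)))       ≡⟨ solve 4 (λ k w o i → k :+ (w :+ (o :+ (i :+ con 1)))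
                                                             := w :+ (k :+ i) :+ (o :+ con 1)) refl
                                                  K W₂ (outdeg v x) I ⟩
      W₂ + (K + I) + (outdeg v x + 1)         ≡⟨ cong (_+ (outdeg v x + 1))
                                                   (weight-colour v₁ (erase-blank v x r₀) x≢0) ⟨
      weight v₁ + outdeg v₁ r + (outdeg v x + 1)
        ≡⟨ cong (λ d → weight v₁ + d + (outdeg v x + 1)) out-r ⟩
      weight v₁ + (outdeg v r + 1) + (outdeg v x + 1)
        ≡⟨ solve 3 (λ w a b → w :+ (a :+ con 1) :+ (b :+ con 1) := w :+ b :+ (a :+ con 2)) refl
             (weight v₁) (outdeg v r) (outdeg v x) ⟩
      weight v₁ + outdeg v x + (outdeg v r + 2)
        ≡⟨ cong (_+ (outdeg v r + 2)) (weight-erase v x x≢0) ⟩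
      weight v + (K + indeg v x) + (outdeg v r + 2)
        ≡⟨ solve 4 (λ w k i o → w :+ (k :+ i) :+ (o :+ con 2) := k :+ (w :+ (i :+ o :+ con 2))) refl
             (weight v) K (indeg v x) (outdeg v r) ⟩
      K + (weight v + (indeg v x + outdeg v r + 2)) ∎)
      where
      open ≡-Reasoning
      K = suc (suc q)
      W₂ = weight (swap v r x)
      I = indeg v₁ r
      in-r : indeg v r ≡ I + 1
      in-r with eq ← indeg-erase v x x≢0 r rewrite rx = eq
      out-r : outdeg v₁ r ≡ outdeg v r + 1
      out-r with eq ← outdeg-erase v x x≢0 r rewrite rx = eq

  -- Local structure of optimal colourings

  freeClass : ∀ v (N : List Vertex) → length N < q →
              ∃ λ l → l ≢ zero × (∀ {y} → y ∈ N → lookup v y ≢ l)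
  freeClass v N short
    -- Forbidding `zero` as well forces a genuine class; at most `q` of the `suc q` colours are then
    -- excluded.
    with l , l∉ ← freeColour (zero ∷ map (lookup v) N) (s≤s (subst (_< q) (sym (length-map (lookup v) N)) short))
    = l , (λ l≡0 → l∉ (here l≡0)) , λ { y∈ refl → l∉ (there (∈-map⁺ (lookup v) y∈)) }

  record Optimal (v : Colouring) : Set where
    constructor optimal
    field
      isProper : Proper v
      minimal  : ∀ w → Proper w → weight v ≤ weight w

  open Optimal

  optimum : ∃ Optimal
  -- The search starts from the colouring that leaves every vertex uncoloured.
  optimum with v , pr , min ← minimiser proper? weight
                 (replicateᵛ order zero , proper λ x _ _ _ → lookup-replicate x zero)
    = v , optimal pr min

  optimal-≤ : ∀ {v w} → Optimal v → Proper w → weight w ≤ weight v → Optimal w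
  optimal-≤ opt pr w≤v = optimal pr λ u pu → ≤-trans w≤v (minimal opt u pu)

  module _ {v : Colouring} (opt : Optimal v) {r : Vertex} (r₀ : lookup v r ≡ zero) where

    -- Otherwise `r` could join class `l`, and minimality would give `2 + q ≤ outdeg v r`, which
    -- exceeds the maximum degree.
    sees-every-class : ∀ l → l ≢ zero → ∃ λ y → Adj r y × lookup v y ≡ l
    sees-every-class l l≢0 = decidable-stable (any? λ y → Adj? r y ×-dec (lookup v y ≟ l)) λ missing →
      let pr′ = recolour-proper (isProper opt) r l λ y ry eq → contradiction (y , ry , eq) missing
          K≤out = ≤-trans (m≤m+n (suc (suc q)) (indeg v r))
                    (+-cancel-≤-≡ (minimal opt _ pr′) (sym (weight-colour v r₀ l≢0)))
      in 1+n≰n (≤-trans K≤out (≤-trans (m≤m+n _ (indeg v r)) (out+in≤1+q v r)))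

    -- A list meeting all classes seen by `r` meets all `q` of them. Applied to neighbour lists with
    -- redundant members deleted, it limits repetitions of classes.
    representatives : (N : List Vertex) →
      (∀ {y} → Adj r y → lookup v y ≢ zero → ∃ λ z → z ∈ N × lookup v z ≡ lookup v y) → q ≤ length N
    representatives N rep = ≮⇒≥ λ short →
      let l , l≢0 , l∉ = freeClass v N short
          y , ry , y≡l = sees-every-class l l≢0
          z , z∈ , z≡y = rep ry (λ y≡0 → l≢0 (trans (sym y≡l) y≡0))
      in l∉ z∈ (trans z≡y y≡l)

    q≤indeg : q ≤ indeg v r
    q≤indeg = representatives (select (inner v r))
      λ {y} ry y≢0 → y , ∈-select⁺ {P = inner v r} (inner⁺ v ry y≢0) , refl

    outdeg≤1 : outdeg v r ≤ 1
    outdeg≤1 = +-cancelʳ-≤ q _ _ (≤-trans (+-monoʳ-≤ (outdeg v r) q≤indeg) (out+in≤1+q v r))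

    blank-neighbour-unique : ∀ {s t} → Adj r s → lookup v s ≡ zero → Adj r t → lookup v t ≡ zero → s ≡ t
    blank-neighbour-unique rs s₀ rt t₀ =
      count≤1⇒unique (outer v r) outdeg≤1 (outer⁺ v rs s₀) (outer⁺ v rt t₀)

    -- A second neighbour `y` in the class of `x` would make `x` redundant, leaving fewer than `q`
    -- vertices to represent `q` classes.
    indeg≤q⇒sole : indeg v r ≤ q → ∀ {x} → Adj r x → lookup v x ≢ zero → Sole v r x
    indeg≤q⇒sole in≤q {x} rx x≢0 y ry eq with y ≟ x
    ... | yes y≡x = y≡x
    ... | no y≢x = contradiction
      (≤-trans (s≤s (representatives (select (without P x)) rep))
        (≤-trans (≤-reflexive (sym (count-without P (inner⁺ v rx x≢0)))) in≤q))
      1+n≰n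
      where
      P = inner v r
      rep : ∀ {z} → Adj r z → lookup v z ≢ zero →
            ∃ λ t → t ∈ select (without P x) × lookup v t ≡ lookup v z
      rep {z} rz z≢0 with z ≟ x
      ... | no z≢x   = z , ∈-select⁺ {P = without P x} (without⁺ P (inner⁺ v rz z≢0) z≢x) , refl
      ... | yes refl = y , ∈-select⁺ {P = without P x}
                             (without⁺ P (inner⁺ v ry (x≢0 ∘ trans (sym eq))) y≢x) , eq

    -- Since r has at most q + 1 coloured neighbours and sees all q classes, only one class
    -- contains two of its neighbours.
    sole-outside-pair : ∀ {u w} → u ≢ w → Adj r u → Adj r w → lookup v u ≢ zero → lookup v u ≡ lookup v w →
                        ∀ {x} → Adj r x → lookup v x ≢ zero → x ≢ u → x ≢ w → Sole v r x
    sole-outside-pair {u} {w} u≢w ru rw u≢0 u≡w {x} rx x≢0 x≢u x≢w y ry eq with y ≟ x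
    ... | yes y≡x = y≡x
    ... | no y≢x = contradiction
      (≤-trans (s≤s (s≤s (representatives (select Q) rep)))
        (≤-trans (≤-reflexive (sym count-Q)) (≤-trans (m≤n+m _ (outdeg v r)) (out+in≤1+q v r))))
      1+n≰n
      where
      P = inner v r
      -- Deleting `u` and `x` loses no class: `w` replaces `u`, and `y` replaces `x`, or `w` does so
      -- if `y` is `u`.
      Q = without (without P u) x

      count-Q : count P ≡ suc (suc (count Q))
      count-Q = trans (count-without P (inner⁺ v ru u≢0))
                      (cong suc (count-without (without P u) (without⁺ P (inner⁺ v rx x≢0) x≢u)))

      Q⁺ : ∀ {z} → Adj r z → lookup v z ≢ zero → z ≢ u → z ≢ x → z ∈ select Q
      Q⁺ rz z≢0 z≢u z≢x =
        ∈-select⁺ {P = Q} (without⁺ (without P u) (without⁺ P (inner⁺ v rz z≢0) z≢u) z≢x)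

      w∈Q : w ∈ select Q
      w∈Q = Q⁺ rw (u≢0 ∘ trans u≡w) (u≢w ∘ sym) (x≢w ∘ sym)

      rep : ∀ {z} → Adj r z → lookup v z ≢ zero → ∃ λ t → t ∈ select Q × lookup v t ≡ lookup v z
      rep {z} rz z≢0 with z ≟ u | z ≟ x | y ≟ u
      ... | yes refl | _        | _        = w , w∈Q , sym u≡w
      ... | no z≢u   | no z≢x   | _        = z , Q⁺ rz z≢0 z≢u z≢x , refl
      ... | no _     | yes refl | yes refl = w , w∈Q , trans (sym u≡w) eq
      ... | no _     | yes refl | no y≢u   = y , Q⁺ ry (x≢0 ∘ trans (sym eq)) y≢u y≢x , eq

    coloured-neighbour : outdeg v r ≡ 0 → ∀ {x} → Adj r x → lookup v x ≢ zero
    coloured-neighbour out≡0 rx x₀ = count≡0⇒none (outer v r) out≡0 (outer⁺ v rx x₀)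

    module _ {x : Vertex} (out≡0 : outdeg v r ≡ 0) (rx : Adj r x) (sole : Sole v r x) where

      private
        x≢0 = coloured-neighbour out≡0 rx

        -- Minimality against the swap of `r` and `x`; adding `outdeg v x` on both sides turns the
        -- inner degrees into full degrees.
        swap-bound : outdeg v x + outdeg v x + degree G r ≤ degree G x + 2
        swap-bound = begin
          outdeg v x + outdeg v x + degree G r
            ≡⟨ cong (outdeg v x + outdeg v x +_) (trans (degree-split v r) (cong (_+ indeg v r) out≡0)) ⟩
          outdeg v x + outdeg v x + indeg v r       ≡⟨ +-assoc (outdeg v x) _ _ ⟩
          outdeg v x + (outdeg v x + indeg v r)     ≤⟨ +-monoʳ-≤ (outdeg v x)
                (+-cancel-≤-≡ (minimal opt _ (swap-proper v r₀ x≢0 (isProper opt) sole)) (swap-weight v r₀ x≢0 rx)) ⟩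
          outdeg v x + (indeg v x + outdeg v r + 2)
            ≡⟨ cong (λ d → outdeg v x + (indeg v x + d + 2)) out≡0 ⟩
          outdeg v x + (indeg v x + 0 + 2)
            ≡⟨ solve 2 (λ o i → o :+ (i :+ con 0 :+ con 2) := o :+ i :+ con 2) refl (outdeg v x) (indeg v x) ⟩
          outdeg v x + indeg v x + 2                ≡⟨ cong (_+ 2) (degree-split v x) ⟨
          degree G x + 2                            ∎
          where open ≤-Reasoning

      -- Thus `r` is the only uncoloured neighbour of `x`: two of them would put `4 + q` below
      -- `3 + q` in `swap-bound`.
      sole⇒outdeg≤1 : outdeg v x ≤ 1
      sole⇒outdeg≤1 = ≮⇒≥ λ 2≤out → 1+n≰n (+-cancelʳ-≤ q 4 3 (begin
        4 + q                                     ≤⟨ +-mono-≤ (+-mono-≤ 2≤out 2≤out) q≤degree ⟩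
        outdeg v x + outdeg v x + degree G r      ≤⟨ swap-bound ⟩
        degree G x + 2                            ≤⟨ +-monoˡ-≤ 2 (Δ≤1+q x) ⟩
        suc q + 2                                 ≡⟨ cong suc (+-comm q 2) ⟩
        3 + q                                     ∎))
        where
        open ≤-Reasoning
        q≤degree : q ≤ degree G r
        q≤degree = ≤-trans q≤indeg (≤-trans (m≤n+m _ (outdeg v r)) (≤-reflexive (sym (degree-split v r))))

      -- As `r` itself counts in `outdeg v x`, `swap-bound` yields `degree G r ≤ degree G x`. This
      -- prepares the use of saturation.
      sole⇒full-degree : degree G r ≡ suc q → degree G x ≡ suc q
      sole⇒full-degree full = ≤-antisym (Δ≤1+q x) (+-cancelˡ-≤ 2 _ _ (begin
        2 + suc q                                 ≤⟨ +-mono-≤ (+-mono-≤ 1≤out 1≤out) (≤-reflexive (sym full)) ⟩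
        outdeg v x + outdeg v x + degree G r      ≤⟨ swap-bound ⟩
        degree G x + 2                            ≡⟨ +-comm _ 2 ⟩
        2 + degree G x                            ∎))
        where
        open ≤-Reasoning
        1≤out : 1 ≤ outdeg v x
        1≤out = count-pos (outer v x) (outer⁺ v (Adj-sym rx) r₀)

  module _ {v : Colouring} (opt : Optimal v) {r : Vertex} (r₀ : lookup v r ≡ zero) where

    -- Swapping r with x keeps the weight minimal, and then t has the two uncoloured
    -- neighbours x and t′.
    paired-blanks : ∀ {s t t′ x} → Adj r s → lookup v s ≡ zero →
                    lookup v t ≡ zero → Adj t t′ → lookup v t′ ≡ zero →
                    lookup v x ≢ zero → Adj r x → Adj x t → r ≢ t → s ≡ t
    paired-blanks {s} {t} {t′} {x} rs s₀ t₀ tt′ t′₀ x≢0 rx xt r≢t with t′ ≟ r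
    ... | yes refl = blank-neighbour-unique opt r₀ rs s₀ (Adj-sym tt′) t₀
    ... | no t′≢r  = contradiction
          (≤-trans (two⇒2≤count (outer v₂ t) (λ { refl → x≢0 t′₀ })
                     (outer⁺ v₂ (Adj-sym xt) x₀′) (outer⁺ v₂ tt′ (blank₂ t′≢r t′₀)))
                   (outdeg≤1 opt₂ (blank₂ (r≢t ∘ sym) t₀)))
          λ { (s≤s ()) }
      where
      v₂ = swap v r x

      blank₂ : ∀ {y} → y ≢ r → lookup v y ≡ zero → lookup v₂ y ≡ zero
      blank₂ y≢r y₀ = trans (lookup∘update′ y≢r (erase v x) (lookup v x)) (erase-blank v x y₀)

      x₀′ : lookup v₂ x ≡ zero
      x₀′ = trans (lookup∘update′ (λ { refl → x≢0 r₀ }) (erase v x) (lookup v x)) (lookup∘update x v zero)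

      -- The uncoloured neighbour `s` leaves room for only `q` coloured ones, so `x` is alone in its
      -- class and the swap is proper.
      in≤q : indeg v r ≤ q
      in≤q = +-cancelˡ-≤ 1 _ _ (≤-trans (+-monoˡ-≤ _ (count-pos (outer v r) (outer⁺ v rs s₀))) (out+in≤1+q v r))

      -- Both `r` and `t` are uncoloured neighbours of `x`, so `x` has at most `q - 1` coloured ones
      -- and the swap does not raise the weight.
      gain : indeg v x + outdeg v r + 2 ≤ outdeg v x + indeg v r
      gain = begin
        indeg v x + outdeg v r + 2          ≤⟨ +-monoˡ-≤ 2 (+-monoʳ-≤ (indeg v x) (outdeg≤1 opt r₀)) ⟩
        indeg v x + 1 + 2                   ≡⟨ solve 1 (λ i → i :+ con 1 :+ con 2 := con 1 :+ (con 2 :+ i)) refl (indeg v x) ⟩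
        1 + (2 + indeg v x)                 ≤⟨ +-monoʳ-≤ 1 (≤-trans (+-monoˡ-≤ (indeg v x) 2≤out) (out+in≤1+q v x)) ⟩
        2 + q                               ≤⟨ +-mono-≤ 2≤out (q≤indeg opt r₀) ⟩
        outdeg v x + indeg v r              ∎
        where
        open ≤-Reasoning
        2≤out : 2 ≤ outdeg v x
        2≤out = two⇒2≤count (outer v x) r≢t (outer⁺ v (Adj-sym rx) r₀) (outer⁺ v xt t₀)

      opt₂ : Optimal v₂
      opt₂ = optimal-≤ opt (swap-proper v r₀ x≢0 (isProper opt) (indeg≤q⇒sole opt r₀ in≤q rx x≢0))
        (+-cancelʳ-≤ (indeg v x + outdeg v r + 2) _ _
          (≤-trans (+-monoʳ-≤ (weight v₂) gain) (≤-reflexive (swap-weight v r₀ x≢0 rx))))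

  -- Distance at most two, and moving a vertex between classes

  Near : Vertex → Vertex → Set
  Near x y = Adj x y ⊎ ∃ λ z → Adj x z × Adj z y

  Near-sym : Symmetric Near
  Near-sym (inj₁ xy)            = inj₁ (Adj-sym xy)
  Near-sym (inj₂ (z , xz , zy)) = inj₂ (z , Adj-sym zy , Adj-sym xz)

  module _ {v : Colouring} (opt : Optimal v) {u : Vertex} {l : Class}
           (u≢0 : lookup v u ≢ zero) (l≢0 : l ≢ zero) where

    private
      v₁ = erase v u
      v′ = v [ u ]≔ l

      u₀ : lookup v₁ u ≡ zero
      u₀ = lookup∘update u v zero

      v₁→v′ : v₁ [ u ]≔ l ≡ v′
      v₁→v′ = []≔-idempotent v u

    -- Both `v` and `v′` arise from `v₁` by colouring `u`, and the effect of that on degrees and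
    -- weight does not depend on the class chosen.
    move-outdeg : ∀ y → outdeg v′ y ≡ outdeg v y
    move-outdeg y = +-cancelʳ-≡ (boolToℕ (adj y u)) _ _ (begin
      outdeg v′ y + boolToℕ (adj y u)                ≡⟨ cong (λ w → outdeg w y + boolToℕ (adj y u)) v₁→v′ ⟨
      outdeg (v₁ [ u ]≔ l) y + boolToℕ (adj y u)     ≡⟨ outdeg-colour v₁ u₀ l≢0 y ⟨
      outdeg v₁ y                                    ≡⟨ outdeg-erase v u u≢0 y ⟩
      outdeg v y + boolToℕ (adj y u)                 ∎)
      where open ≡-Reasoning

    move-weight : weight v′ ≡ weight v
    move-weight = +-cancelʳ-≡ (suc (suc q) + indeg v₁ u) _ _ (begin
      weight v′ + (suc (suc q) + indeg v₁ u)              ≡⟨ cong (λ w → weight w + (suc (suc q) + indeg v₁ u)) v₁→v′ ⟨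
      weight (v₁ [ u ]≔ l) + (suc (suc q) + indeg v₁ u)   ≡⟨ weight-colour v₁ u₀ l≢0 ⟨
      weight v₁ + outdeg v₁ u                             ≡⟨ weight-colour v₁ u₀ u≢0 ⟩
      weight (v₁ [ u ]≔ lookup v u) + (suc (suc q) + indeg v₁ u)
        ≡⟨ cong (λ w → weight w + (suc (suc q) + indeg v₁ u)) (erase-restore v u) ⟩
      weight v + (suc (suc q) + indeg v₁ u)               ∎)
      where open ≡-Reasoning

    move-optimal : (∀ y → Adj u y → lookup v y ≢ l) → Optimal v′
    move-optimal free = optimal-≤ opt
      (recolour-proper (isProper opt) u l λ y uy eq → contradiction eq (free y uy))
      (≤-reflexive move-weight)

  -- Saturation and the surroundings of an uncoloured vertex without uncoloured neighbours

  module _ (saturated : ∀ x → degree G x ≡ suc q → degNeighbours G (suc q) x ≤ q) where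

    some-smaller-neighbour : ∀ {r} → degree G r ≡ suc q → ¬ (∀ y → Adj r y → degree G y ≡ suc q)
    some-smaller-neighbour {r} full all = 1+n≰n (begin
      suc q                       ≡⟨ full ⟨
      degree G r                  ≡⟨ count-cong agree ⟩
      degNeighbours G (suc q) r   ≤⟨ saturated r full ⟩
      q                           ∎)
      where
      open ≤-Reasoning
      agree : ∀ y → adj r y ≡ adj r y ∧ (degree G y ≡ᵇ suc q)
      agree y with adj r y in eq
      ... | false = refl
      ... | true  = sym (Equivalence.to T-≡ (≡⇒≡ᵇ _ _ (all y eq)))

    module _ (3≤q : 3 ≤ q) {v : Colouring} (opt : Optimal v) {r : Vertex}
             (r₀ : lookup v r ≡ zero) (out≡0 : outdeg v r ≡ 0) where

      private
        coloured : ∀ {x} → Adj r x → lookup v x ≢ zero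
        coloured = coloured-neighbour opt r₀ out≡0

      -- The neighbours of `r` in a common class; by `sole-outside-twins` there is at most one such
      -- pair, up to order.
      Twins : Vertex → Vertex → Set
      Twins u w = u ≢ w × Adj r u × Adj r w × lookup v u ≡ lookup v w

      twins? : ∀ u w → Dec (Twins u w)
      twins? u w = ¬? (u ≟ w) ×-dec Adj? r u ×-dec Adj? r w ×-dec (lookup v u ≟ lookup v w)

      twins-sym : ∀ {u w} → Twins u w → Twins w u
      twins-sym (u≢w , ru , rw , eq) = u≢w ∘ sym , rw , ru , sym eq

      sole-outside-twins : ∀ {u w x} → Twins u w → Adj r x → x ≢ u → x ≢ w → Sole v r x
      sole-outside-twins (u≢w , ru , rw , eq) rx =
        sole-outside-pair opt r₀ u≢w ru rw (coloured ru) eq rx (coloured rx)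

      -- With at most `q` coloured neighbours, each would be alone in its class.
      twins⇒full-degree : ∀ {u w} → Twins u w → degree G r ≡ suc q
      twins⇒full-degree (u≢w , ru , rw , eq) = ≤-antisym (Δ≤1+q r) (begin
        suc q                     ≤⟨ ≰⇒> (λ in≤q → u≢w (indeg≤q⇒sole opt r₀ in≤q rw (coloured rw) _ ru eq)) ⟩
        indeg v r                 ≤⟨ m≤n+m _ (outdeg v r) ⟩
        outdeg v r + indeg v r    ≡⟨ degree-split v r ⟨
        degree G r                ∎)
        where open ≤-Reasoning

      module _ {u w : Vertex} (tw : Twins u w) {l : Class} (l≢0 : l ≢ zero)
               (u≢l : lookup v u ≢ l) (free : ∀ y → Adj u y → lookup v y ≢ l) where

        private
          u≢w = proj₁ tw
          ru  = proj₁ (proj₂ tw)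
          rw  = proj₁ (proj₂ (proj₂ tw))
          u≡w = proj₂ (proj₂ (proj₂ tw))
          full = twins⇒full-degree tw
          v′ = v [ u ]≔ l

          opt′ : Optimal v′
          opt′ = move-optimal opt (coloured ru) l≢0 free

          r₀′ : lookup v′ r ≡ zero
          r₀′ = trans (lookup∘update′ (λ { refl → coloured ru r₀ }) v l) r₀

          out≡0′ : outdeg v′ r ≡ 0
          out≡0′ = trans (move-outdeg opt (coloured ru) l≢0 r) out≡0

          -- Any further neighbour of `r` in the class of `w` would already be lone in `v`, yet `u`
          -- shares that class there.
          sole-w : Sole v′ r w
          sole-w y ry eq with y ≟ u
          ... | yes refl = contradiction
                (trans u≡w (trans (sym (lookup∘update′ (u≢w ∘ sym) v l)) (trans (sym eq) (lookup∘update u v l))))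
                u≢l
          ... | no y≢u = decidable-stable (y ≟ w) λ y≢w →
                u≢w (trans (u≡y y≢w) (contradiction (u≡y y≢w) (y≢u ∘ sym)))
            where
            y≡w : lookup v y ≡ lookup v w
            y≡w = trans (sym (lookup∘update′ y≢u v l)) (trans eq (lookup∘update′ (u≢w ∘ sym) v l))
            u≡y : y ≢ w → u ≡ y
            u≡y y≢w = sole-outside-twins tw ry y≢u y≢w u ru (trans u≡w (sym y≡w))

        twin-of-movable-outdeg≤1 : outdeg v w ≤ 1
        twin-of-movable-outdeg≤1 = subst (_≤ 1) (move-outdeg opt (coloured ru) l≢0 w)
          (sole⇒outdeg≤1 opt′ r₀′ out≡0′ rw sole-w)

        -- Otherwise `u` has full degree, and so has every other neighbour of `r`, being lone in `v`
        -- or, for `w`, in `v′`; this contradicts saturation.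
        movable-outdeg≤q : outdeg v u ≤ q
        movable-outdeg≤q = ≮⇒≥ λ q<out → some-smaller-neighbour full (all-full q<out)
          where
          all-full : q < outdeg v u → ∀ y → Adj r y → degree G y ≡ suc q
          all-full q<out y ry with y ≟ u | y ≟ w
          ... | yes refl | _ = ≤-antisym (Δ≤1+q u)
                (≤-trans q<out (≤-trans (m≤m+n _ (indeg v u)) (≤-reflexive (sym (degree-split v u)))))
          ... | no _   | yes refl = sole⇒full-degree opt′ r₀′ out≡0′ rw sole-w full
          ... | no y≢u | no y≢w   =
                sole⇒full-degree opt r₀ out≡0 ry (sole-outside-twins tw ry y≢u y≢w) full

      crowded-twin : ∀ {u w} → Twins u w → 3 ≤ outdeg v u → outdeg v w ≤ 1 × outdeg v u ≤ q
      crowded-twin {u} tw 3≤out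
        -- Three uncoloured neighbours leave at most `q - 2` coloured ones. Listing `u` too makes
        -- the free class differ from its own.
        with l , l≢0 , fresh ← freeClass v (u ∷ select (inner v u))
               (+-cancelˡ-≤ 1 _ _ (≤-trans (+-monoˡ-≤ (indeg v u) 3≤out) (out+in≤1+q v u)))
        = twin-of-movable-outdeg≤1 tw l≢0 (fresh (here refl)) free ,
          movable-outdeg≤q tw l≢0 (fresh (here refl)) free
        where
        free : ∀ y → Adj u y → lookup v y ≢ l
        free y uy y≡l = fresh (there (∈-select⁺ {P = inner v u} (inner⁺ v uy (l≢0 ∘ trans (sym y≡l))))) y≡l

      -- Here `a` and `b` count uncoloured neighbours other than `r`. If one twin has three
      -- uncoloured neighbours, the other sees only `r`; otherwise the sum is at most `2`, which is
      -- below `q`.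
      few-near-twins : ∀ {u w} → Twins u w → ∀ a b → outdeg v u ≡ suc a → outdeg v w ≡ suc b → a + b < q
      few-near-twins {u} {w} tw a b eqᵤ eqʷ with 3 ≤? outdeg v u | 3 ≤? outdeg v w
      ... | yes 3≤u | _ = begin-strict
        a + b          ≤⟨ +-monoʳ-≤ a (≤-pred (subst (_≤ 1) eqʷ (proj₁ (crowded-twin tw 3≤u)))) ⟩
        a + 0          ≡⟨ +-identityʳ a ⟩
        a              <⟨ subst (_≤ q) eqᵤ (proj₂ (crowded-twin tw 3≤u)) ⟩
        q              ∎
        where open ≤-Reasoning
      ... | no _ | yes 3≤w = begin-strict
        a + b          ≤⟨ +-monoˡ-≤ b (≤-pred (subst (_≤ 1) eqᵤ (proj₁ (crowded-twin (twins-sym tw) 3≤w)))) ⟩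
        b              <⟨ subst (_≤ q) eqʷ (proj₂ (crowded-twin (twins-sym tw) 3≤w)) ⟩
        q              ∎
        where open ≤-Reasoning
      ... | no u<3 | no w<3 = begin-strict
        a + b          ≤⟨ +-mono-≤ (small eqᵤ u<3) (small eqʷ w<3) ⟩
        2              <⟨ 3≤q ⟩
        q              ∎
        where
        open ≤-Reasoning
        small : ∀ {d e} → d ≡ suc e → ¬ 3 ≤ d → e ≤ 1
        small refl d<3 = ≤-pred (≤-pred (≰⇒> d<3))

      -- A lone neighbour of `r` sees no uncoloured vertex but `r`, so other uncoloured vertices are
      -- reached only through twins.
      few-near-lonely : ∃ λ bad → length bad < q ×
        (∀ {y} → lookup v y ≡ zero → r ≢ y → Near r y → y ∈ bad)
      few-near-lonely with any? (λ u → any? (twins? u))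
      ... | no none = [] , ≤-trans (s≤s z≤n) 3≤q , catch
        where
        catch : ∀ {y} → lookup v y ≡ zero → r ≢ y → Near r y → y ∈ []
        catch y₀ r≢y (inj₁ ry) = contradiction y₀ (coloured ry)
        catch y₀ r≢y (inj₂ (z , rz , zy)) = contradiction
          (count≤1⇒unique (outer v z) (sole⇒outdeg≤1 opt r₀ out≡0 rz sole)
            (outer⁺ v (Adj-sym rz) r₀) (outer⁺ v zy y₀)) r≢y
          where
          sole : Sole v r z
          sole t rt eq = decidable-stable (t ≟ z) λ t≢z → none (t , z , t≢z , rt , rz , eq)
      ... | yes (u , w , tw@(u≢w , ru , rw , eq)) = bad , short , catch
        where
        via : Vertex → Vertex → Bool
        via x = without (outer v x) r

        bad = select (via u) ++ select (via w)

        outdeg-via : ∀ {x} → Adj r x → outdeg v x ≡ suc (count (via x))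
        outdeg-via {x} rx = count-without (outer v x) (outer⁺ v (Adj-sym rx) r₀)

        short : length bad < q
        short = subst (_< q) (sym (length-++ (select (via u))))
          (few-near-twins tw _ _ (outdeg-via ru) (outdeg-via rw))

        via⁺ : ∀ {x y} → Adj x y → lookup v y ≡ zero → r ≢ y → y ∈ select (via x)
        via⁺ {x} xy y₀ r≢y =
          ∈-select⁺ {P = via x} (without⁺ (outer v x) (outer⁺ v xy y₀) (r≢y ∘ sym))

        catch : ∀ {y} → lookup v y ≡ zero → r ≢ y → Near r y → y ∈ bad
        catch y₀ r≢y (inj₁ ry) = contradiction y₀ (coloured ry)
        catch y₀ r≢y (inj₂ (z , rz , zy)) with z ≟ u | z ≟ w
        ... | yes refl | _        = ∈-++⁺ˡ (via⁺ zy y₀ r≢y)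
        ... | no _     | yes refl = ∈-++⁺ʳ (select (via u)) (via⁺ zy y₀ r≢y)
        ... | no z≢u   | no z≢w   = contradiction
              (count≤1⇒unique (outer v z)
                (sole⇒outdeg≤1 opt r₀ out≡0 rz (sole-outside-twins tw rz z≢u z≢w))
                (outer⁺ v (Adj-sym rz) r₀) (outer⁺ v zy y₀)) r≢y

    -- Colouring the uncoloured vertices

    -- If `r` and `t` are adjacent or have an uncoloured middle vertex, uniqueness of uncoloured
    -- neighbours decides; a coloured middle vertex is the case of `paired-blanks`.
    near-paired : ∀ {v} → Optimal v → ∀ {r s t t′} → lookup v r ≡ zero →
                  Adj r s → lookup v s ≡ zero → lookup v t ≡ zero → Adj t t′ → lookup v t′ ≡ zero →
                  r ≢ t → Near r t → s ≡ t
    near-paired opt r₀ rs s₀ t₀ tt′ t′₀ r≢t (inj₁ rt) = blank-neighbour-unique opt r₀ rs s₀ rt t₀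
    near-paired {v} opt r₀ rs s₀ t₀ tt′ t′₀ r≢t (inj₂ (z , rz , zt)) with lookup v z ≟ zero
    ... | yes z₀ = contradiction (blank-neighbour-unique opt z₀ (Adj-sym rz) r₀ zt t₀) r≢t
    ... | no z≢0 = paired-blanks opt r₀ rs s₀ t₀ tt′ t′₀ z≢0 rz zt r≢t

    -- Paired vertices come first, since their conflicts are bounded only among themselves; for
    -- lonely ones `few-near-lonely` counts all uncoloured vertices.
    colour-blanks : 3 ≤ q → ∀ {v} → Optimal v → ∃ λ (g : Vertex → Fin q) →
      ∀ {x y} → lookup v x ≡ zero → lookup v y ≡ zero → x ≢ y → Near x y → g x ≢ g y
    colour-blanks 3≤q {v} opt =
      proj₁ coloured , λ x₀ y₀ → proj₂ coloured (listed x₀) (listed y₀)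
      where
      lonelyᵇ pairedᵇ : Vertex → Bool
      lonelyᵇ x = blank v x ∧ (outdeg v x ≡ᵇ 0)
      pairedᵇ x = blank v x ∧ not (outdeg v x ≡ᵇ 0)

      lonely paired : List Vertex
      lonely = select lonelyᵇ
      paired = select pairedᵇ

      listed : ∀ {x} → lookup v x ≡ zero → x ∈ lonely ++ paired
      listed {x} x₀ with outdeg v x ≡ᵇ 0 in eq
      ... | true  = ∈-++⁺ˡ (∈-select⁺ {P = lonelyᵇ} (cong₂ _∧_ (cong isZero x₀) eq))
      ... | false = ∈-++⁺ʳ lonely (∈-select⁺ {P = pairedᵇ} (cong₂ (λ a b → a ∧ not b) (cong isZero x₀) eq))

      lonely⁻ : ∀ {x} → x ∈ lonely → lookup v x ≡ zero × outdeg v x ≡ 0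
      lonely⁻ {x} x∈ with px ← ∈-select⁻ {P = lonelyᵇ} x∈ =
        isZero⇒≡ (∧-conicalˡ _ _ px) , ≡ᵇ⇒≡ _ _ (Equivalence.from T-≡ (∧-conicalʳ (blank v x) _ px))

      paired⁻ : ∀ {x} → x ∈ paired → lookup v x ≡ zero × ∃ λ s → Adj x s × lookup v s ≡ zero
      paired⁻ {x} x∈ with px ← ∈-select⁻ {P = pairedᵇ} x∈ with none-or-some (outer v x)
      ... | inj₁ out≡0 with () ← trans (sym (∧-conicalʳ (blank v x) _ px)) (cong (λ d → not (d ≡ᵇ 0)) out≡0)
      ... | inj₂ (s , p) = isZero⇒≡ (∧-conicalˡ _ _ px) ,
                           s , ∧-conicalˡ _ _ p , isZero⇒≡ (∧-conicalʳ (adj x s) _ p)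

      blank⁻ : ∀ {x} → x ∈ lonely ++ paired → lookup v x ≡ zero
      blank⁻ x∈ with ∈-++⁻ lonely x∈
      ... | inj₁ x∈l = proj₁ (lonely⁻ x∈l)
      ... | inj₂ x∈p = proj₁ (paired⁻ x∈p)

      few-paired : ∀ {x} → x ∈ paired → FewNeighbours Near-sym {q} (paired ++ []) x
      few-paired x∈ with x₀ , s , xs , s₀ ← paired⁻ x∈ =
        -- Among paired vertices only the partner `s` can conflict.
        s ∷ [] , ≤-trans (s≤s (s≤s z≤n)) 3≤q , λ {y} y∈ x≢y near →
          let y₀ , t , yt , t₀ = paired⁻ (subst (y ∈_) (++-identityʳ paired) y∈)
          in here (sym (near-paired opt x₀ xs s₀ y₀ yt t₀ x≢y near))

      few-lonely : ∀ {x} → x ∈ lonely → FewNeighbours Near-sym {q} (lonely ++ paired) x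
      few-lonely x∈ with x₀ , out≡0 ← lonely⁻ x∈
                    with bad , short , catch ← few-near-lonely 3≤q opt x₀ out≡0
        = bad , short , λ y∈ → catch (blank⁻ y∈)

      coloured : ∃ (ProperOn Near-sym {q} (lonely ++ paired))
      coloured = greedy Near-sym lonely paired few-lonely
        (subst (λ ys → ∃ (ProperOn Near-sym {q} ys)) (++-identityʳ paired)
          (greedy Near-sym paired [] few-paired (start , λ ())))
        where
        start : Vertex → Fin q
        start _ = fromℕ< (≤-trans (s≤s z≤n) 3≤q)

-- From classes and colours to a packing colouring

-- Two independent lengths let `position` recurse on the block of ones alone.
oneTwo : ℕ → ℕ → List ℕ
oneTwo p q = replicate p 1 ++ replicate q 2

gap : ∀ {p q} → Fin p ⊎ Fin q → ℕ
gap (inj₁ _) = 1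
gap (inj₂ _) = 2

position : ∀ p q → Fin p ⊎ Fin q → Fin (length (oneTwo p q))
position zero    (suc q) (inj₂ zero)    = zero
position zero    (suc q) (inj₂ (suc j)) = suc (position zero q (inj₂ j))
position (suc p) q       (inj₁ zero)    = zero
position (suc p) q       (inj₁ (suc i)) = suc (position p q (inj₁ i))
position (suc p) q       (inj₂ j)       = suc (position p q (inj₂ j))

lookup-position : ∀ p q s → List.lookup (oneTwo p q) (position p q s) ≡ gap s
lookup-position zero    (suc q) (inj₂ zero)    = refl
lookup-position zero    (suc q) (inj₂ (suc j)) = lookup-position zero q (inj₂ j)
lookup-position (suc p) q       (inj₁ zero)    = refl
lookup-position (suc p) q       (inj₁ (suc i)) = lookup-position p q (inj₁ i)
lookup-position (suc p) q       (inj₂ j)       = lookup-position p q (inj₂ j)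

position-injective : ∀ p q {s t} → position p q s ≡ position p q t → s ≡ t
position-injective zero (suc q) {inj₂ zero}    {inj₂ zero}    _ = refl
position-injective zero (suc q) {inj₂ (suc i)} {inj₂ (suc j)} eq
  with refl ← position-injective zero q {inj₂ i} {inj₂ j} (suc-injective eq) = refl
position-injective (suc p) q {inj₁ zero}    {inj₁ zero}    _ = refl
position-injective (suc p) q {inj₁ (suc i)} {inj₁ (suc j)} eq
  with refl ← position-injective p q {inj₁ i} {inj₁ j} (suc-injective eq) = refl
position-injective (suc p) q {inj₁ (suc i)} {inj₂ j} eq
  with () ← position-injective p q {inj₁ i} {inj₂ j} (suc-injective eq)
position-injective (suc p) q {inj₂ i} {inj₁ (suc j)} eq
  with () ← position-injective p q {inj₂ i} {inj₁ j} (suc-injective eq)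
position-injective (suc p) q {inj₂ i} {inj₂ j} eq
  with refl ← position-injective p q {inj₂ i} {inj₂ j} (suc-injective eq) = refl

module _ {q : ℕ} (G : Graph) (Δ≤1+q : MaxDegreeLe G (suc q)) where

  open PartialColourings G q Δ≤1+q

  walk≤1 : ∀ {x y} → x ≢ y → DistLe G x y 1 → Adj x y
  walk≤1 x≢y (_ , _ , here)                = contradiction refl x≢y
  walk≤1 x≢y (_ , _ , step xy here)        = xy
  walk≤1 x≢y (_ , s≤s () , step _ (step _ _))

  walk≤2 : ∀ {x y} → x ≢ y → DistLe G x y 2 → Near x y
  walk≤2 x≢y (_ , _ , here)                    = contradiction refl x≢y
  walk≤2 x≢y (_ , _ , step xy here)            = inj₁ xy
  walk≤2 x≢y (_ , _ , step xz (step zy here))  = inj₂ (_ , xz , zy)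
  walk≤2 x≢y (_ , s≤s (s≤s ()) , step _ (step _ (step _ _)))

  assemble : ∀ {v} → Proper v → (g : Vertex → Fin q) →
             (∀ {x y} → lookup v x ≡ zero → lookup v y ≡ zero → x ≢ y → Near x y → g x ≢ g y) →
             PackingColorable G (oneTwo q q)
  assemble {v} pr g g-proper = position q q ∘ colour , packing
    where
    -- Nonzero classes become the colours of gap `1`; class `zero` is split by `g` into colours of
    -- gap `2`.
    side : Class → Fin q → Fin q ⊎ Fin q
    side zero    j = inj₂ j
    side (suc i) _ = inj₁ i

    colour : Vertex → Fin q ⊎ Fin q
    colour x = side (lookup v x) (g x)

    separated : ∀ x y → x ≢ y → colour x ≡ colour y → ¬ DistLe G x y (gap (colour x))
    separated x y x≢y eq near with lookup v x in vx | lookup v y in vy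
    separated x y x≢y eq near   | zero  | zero   = g-proper vx vy x≢y (walk≤2 x≢y near) (inj₂-injective eq)
    separated x y x≢y refl near | suc i | suc .i
      with () ← trans (sym vx) (Proper.monochromatic⇒blank pr x y (walk≤1 x≢y near) (trans vx (sym vy)))

    packing : PackingColoring G (oneTwo q q) (position q q ∘ colour)
    packing x y x≢y eq rewrite lookup-position q q (colour x) =
      separated x y x≢y (position-injective q q eq)

theorem4p1 : (k : ℕ) → 4 ≤ k → (G : Graph) → MaxDegreeLe G k → Saturated G k (k ∸ 1) → PackingColorable G (seq1-2 k)
-- With `k` matched as `suc q`, `k ∸ 1` computes to `q`, so the sequence becomes `oneTwo q q`.
theorem4p1 (suc q) (s≤s 3≤q) G Δ≤k (_ , saturated)
  with v , opt ← PartialColourings.optimum G q Δ≤k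
  with g , g-proper ← PartialColourings.colour-blanks G q Δ≤k saturated 3≤q opt
  = assemble G Δ≤k (PartialColourings.Optimal.isProper opt) g g-proper
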